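{- Let $\mathcal P^u\in\mathcal B$ be a basic class and let $x\in{}^*\mathbb N$. If, for every $A\in\mathcal P^u\cap\mathcal C$, $x$ has infinitely many exact factors from ${}^*A$, then $x$ also has infinitely many exact factors which are generators of $\mathcal P^u$.
   Context: Divisibility of ultrafilters. $\mathbb N=\{1,2,3,\dots\}$, $\mathbb P$ is the set of primes, $\beta\mathbb N$ is the set of ultrafilters on $\mathbb N$, with $n\in\mathbb N$ identified with the principal ultrafilter at $n$. For $A\subseteq\mathbb N$ let $A\uparrow=\{n\in\mathbb N:(\exists a\in A)\,a\mid n\}$, and $\mathcal U=\{A\subseteq\mathbb N: A\ne\emptyset,\ A=A\uparrow\}$. For $\mathcal F,\mathcal G\in\beta\mathbb N$: $\mathcal F\,\widetilde{\mid}\,\mathcal G$ iff $\mathcal F\cap\mathcal U\subseteq\mathcal G$; $\mathcal F=_\sim\mathcal G$ iff $\mathcal F\,\widetilde{\mid}\,\mathcal G$ and $\mathcal G\,\widetilde{\mid}\,\mathcal F$. Nonstandard extension. Standing assumption: we work in a fixed nonstandard extension ${}^*$ (of a superstructure over $\mathbb N$) which is $\mathfrak c^+$-saturated and satisfies Henson's isomorphism property (any two elementarily equivalent internally presented structures, for a finite first-order language, are isomorphic). For $x\in{}^*\mathbb N$, $tp(x/\mathbb N)=\{A\subseteq\mathbb N:x\in{}^*A\}\in\beta\mathbb N$; $x\models\mathcal F$ ($x$ is a generator of $\mathcal F$) means $tp(x/\mathbb N)=\mathcal F$. Basic classes. $\overline{\mathbb P}=\{\mathcal P\in\beta\mathbb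 N:\mathbb P\in\mathcal P\}$. For $\mathcal P\in\overline{\mathbb P}$, on pairs $(p,a)$ with $p\models\mathcal P$, $a\in{}^*\mathbb N$, put $(p,a)\approx_{\mathcal P}(q,b)$ iff $tp(p^a/\mathbb N)=_\sim tp(q^b/\mathbb N)$; $\mathcal E_{\mathcal P}$ is the set of $\approx_{\mathcal P}$-classes. For $u\in\mathcal E_{\mathcal P}$ the set $\mathcal P^u=\{tp(p^a/\mathbb N):(p,a)\in u\}$ is called a basic class, and $\mathcal B$ is the set of all basic classes. $p^a$ is a generator of $\mathcal P^u$ if it is a generator of some $\mathcal F\in\mathcal P^u$. For $A\subseteq\mathbb N$, $A\in\mathcal P^u$ means $A\in\mathcal F$ for all $\mathcal F\in\mathcal P^u$. Exact factors. For $x\in{}^*\mathbb N$, $p\in{}^*\mathbb P$, $a\in{}^*\mathbb N$, $p^a$ is an exact factor (exact divisor) of $x$ if $x=p^ax'$ with $p$ not dividing $x'$ in ${}^*\mathbb N$. Convex sets. $\mathbb P^{exp}=\{p^n:p\in\mathbb P,n\in\mathbb N\}$. $A\subseteq\mathbb N$ is convex if $a,b\in A$, $a\mid c$, $c\mid b$ imply $c\in A$. $\mathcal C$ is the family of nonempty convex subsets of $\mathbb P^{exp}$; $\mathcal P^u\cap\mathcal C=\{A\in\mathcal C:A\in\mathcal P^u\}$. -}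

module Defs where

open import Data.Bool.Base using (Bool; true; false; if_then_else_)
open import Data.Empty using (⊥; ⊥-elim)
open import Data.Fin.Base using (Fin; zero; suc)
open import Data.Irrelevant using ([_])
open import Data.List.Base using (List)
import Data.List.Membership.Propositional as List
open import Data.List.Relation.Unary.All using (All)
open import Data.Nat.Base as ℕ using (ℕ; zero; suc; NonZero; s≤s; _⊔_)
import Data.Nat.Divisibility as ℕ
import Data.Nat.Primality as ℕ
import Data.Nat.Properties as ℕ
open import Data.Product using (Σ; ∃; ∃₂; _×_; _,_; proj₁; proj₂)
open import Data.Refinement using (Refinement-syntax; _,_; value)
open import Data.Sum.Base using (_⊎_; inj₁; inj₂)
open import Data.Unit.Base using (tt)
open import Data.Vec.Base using (Vec; []; _∷_; _∷ʳ_; lookup; map)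
open import Function.Base using (_∘_)
open import Function.Bundles using (_⇔_; Bijection; module Equivalence)
open import Level using (Level; 0ℓ) renaming (suc to lsuc)
open import Relation.Binary.Bundles using (Setoid)
open import Relation.Binary.PropositionalEquality using (_≡_; refl; sym; trans)
open import Relation.Nullary using (¬_)
open import Relation.Unary using (Pred; Satisfiable; U; ∅; ∁; _∩_; _⊆_; _≐_)

private variable
  a ℓ : Level
  X : Set
  k m n : ℕ

Infinite : {A : Set a} → Pred A ℓ → Set _
Infinite {A = A} P = ¬ (∃ λ (xs : List A) → ∀ x → P x → x List.∈ xs)

ℕ⁺ : Set
ℕ⁺ = [ n ∈ ℕ ∣ NonZero n ]

infixl 7 _·_
infixr 8 _^_
infix 4 _∣_

_·_ : ℕ⁺ → ℕ⁺ → ℕ⁺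
(m , [ m≢0 ]) · (n , [ n≢0 ]) = m ℕ.* n , [ ℕ.m*n≢0 m n {{m≢0}} {{n≢0}} ]

_^_ : ℕ⁺ → ℕ⁺ → ℕ⁺
(m , [ m≢0 ]) ^ (n , _) = m ℕ.^ n , [ ℕ.m^n≢0 m n {{m≢0}} ]

_∣_ : ℕ⁺ → ℕ⁺ → Set
m ∣ n = value m ℕ.∣ value n

Subset : Set₁
Subset = Pred ℕ⁺ 0ℓ

ℙ : Subset
ℙ n = ℕ.Prime (value n)

ℙexp : Subset
ℙexp m = ∃₂ λ p n → ℙ p × m ≡ p ^ n

_↑ : Subset → Subset
(A ↑) n = ∃ λ a → A a × a ∣ n

𝒰 : Pred Subset 0ℓ
𝒰 A = Satisfiable A × A ≐ A ↑

Convex : Pred Subset 0ℓ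
Convex A = ∀ {a b c} → A a → A b → a ∣ c → c ∣ b → A c

𝒞 : Pred Subset 0ℓ
𝒞 A = Satisfiable A × A ⊆ ℙexp × Convex A

record βℕ : Set₁ where
  field
    _∋_       : Pred Subset 0ℓ
    ∋-whole   : _∋_ U
    ∌-empty   : ¬ _∋_ ∅
    ∋-upward  : ∀ {A B} → A ⊆ B → _∋_ A → _∋_ B
    ∋-∩       : ∀ {A B} → _∋_ A → _∋_ B → _∋_ (A ∩ B)
    ∋-ultra   : ∀ A → ¬ _∋_ A → _∋_ (∁ A)

open βℕ public using (_∋_)

infix 4 _∣~_ _=~_

_∣~_ : βℕ → βℕ → Set₁
F ∣~ G = ∀ A → F ∋ A → 𝒰 A → G ∋ A

_=~_ : βℕ → βℕ → Set₁
F =~ G = (F ∣~ G) × (G ∣~ F)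

-- V X n is the n-th level of the superstructure over the set X of atoms:
-- V X 0 = X and V X (1 + n) consists of the atoms together with the
-- subsets of V X n, a subset being presented by a small indexed family of
-- its elements.  Presentations are compared by the extensional equality
-- _≈ᵥ_.  Classically every subset of V X n has such a presentation,
-- because V X n modulo _≈ᵥ_ is the image of a small type.

data V (X : Set) : ℕ → Set₁ where
  atom : X → V X n
  set  : (I : Set) → (I → V X n) → V X (suc n)

infix 4 _≈ᵥ_ _≈_ _∈_

_≈ᵥ_ : V X m → V X n → Set
atom x  ≈ᵥ atom y  = x ≡ y
atom _  ≈ᵥ set _ _ = ⊥
set _ _ ≈ᵥ atom _  = ⊥
set I f ≈ᵥ set J g = (∀ i → ∃ λ j → f i ≈ᵥ g j) × (∀ j → ∃ λ i → f i ≈ᵥ g j)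

V∞ : Set → Set₁
V∞ X = ∃ (V X)

_≈_ : V∞ X → V∞ X → Set
(_ , v) ≈ (_ , w) = v ≈ᵥ w

Elem : V∞ X → Set
Elem (_ , atom _)  = ⊥
Elem (_ , set I _) = I

elem : (w : V∞ X) → Elem w → V∞ X
elem (_ , set _ f) i = _ , f i

_∈_ : V∞ X → V∞ X → Set
v ∈ w = ∃ λ i → v ≈ elem w i

at : X → V∞ X
at x = 0 , atom x

base : (X : Set) → V∞ X
base X = 1 , set X atom

⌜_⌝ : Pred X 0ℓ → V∞ X
⌜ A ⌝ = 1 , set (∃ A) (atom ∘ proj₁)

raise : m ℕ.≤ n → V X m → V X n
raise _         (atom x)  = atom x
raise (s≤s m≤n) (set I f) = set I (raise m≤n ∘ f)

upair : V∞ X → V∞ X → V∞ X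
upair (m , v) (n , w) = suc (m ⊔ n) ,
  set Bool (λ b → if b then raise (ℕ.m≤m⊔n m n) v else raise (ℕ.m≤n⊔m m n) w)

⟨_,_⟩ : V∞ X → V∞ X → V∞ X
⟨ v , w ⟩ = upair (upair v v) (upair v w)

tuple : Vec (V∞ X) n → V∞ X
tuple []           = 1 , set ⊥ ⊥-elim
tuple (v ∷ [])     = v
tuple (v ∷ w ∷ vs) = ⟨ v , tuple (w ∷ vs) ⟩

⌜_⌝₂ : (X → X → Set) → V∞ X
⌜_⌝₂ {X} R = _ , set (∃₂ λ x y → R x y) λ (x , y , _) → proj₂ ⟨ at x , at y ⟩

graph : (X → X → X) → V∞ X
graph {X} f = _ , set (X × X) λ (x , y) → proj₂ ⟨ at x , ⟨ at y , at (f x y) ⟩ ⟩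

≈ᵥ-refl : (v : V X n) → v ≈ᵥ v
≈ᵥ-refl (atom _)  = refl
≈ᵥ-refl (set _ f) = (λ i → i , ≈ᵥ-refl (f i)) , (λ i → i , ≈ᵥ-refl (f i))

≈ᵥ-sym : (v : V X m) (w : V X n) → v ≈ᵥ w → w ≈ᵥ v
≈ᵥ-sym (atom _)  (atom _)  p       = sym p
≈ᵥ-sym (set _ f) (set _ g) (p , q) =
  (λ j → let i , r = q j in i , ≈ᵥ-sym (f i) (g j) r) ,
  (λ i → let j , r = p i in j , ≈ᵥ-sym (f i) (g j) r)

≈ᵥ-trans : (u : V X k) (v : V X m) (w : V X n) → u ≈ᵥ v → v ≈ᵥ w → u ≈ᵥ w
≈ᵥ-trans (atom _)  (atom _)  (atom _)  p       q         = trans p q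
≈ᵥ-trans (set _ f) (set _ g) (set _ h) (p , q) (p′ , q′) =
  (λ i → let j , r = p i ; l , s = p′ j in l , ≈ᵥ-trans (f i) (g j) (h l) r s) ,
  (λ l → let j , s = q′ l ; i , r = q j in i , ≈ᵥ-trans (f i) (g j) (h l) r s)

≈-refl : (v : V∞ X) → v ≈ v
≈-refl (_ , v) = ≈ᵥ-refl v

≈-sym : (v w : V∞ X) → v ≈ w → w ≈ v
≈-sym (_ , v) (_ , w) = ≈ᵥ-sym v w

≈-trans : (u v w : V∞ X) → u ≈ v → v ≈ w → u ≈ w
≈-trans (_ , u) (_ , v) (_ , w) = ≈ᵥ-trans u v w

∈-resp-≈ˡ : (u v w : V∞ X) → u ≈ v → u ∈ w → v ∈ w
∈-resp-≈ˡ u v w u≈v (i , p) = i , ≈-trans v u (elem w i) (≈-sym u v u≈v) p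

∈-resp-≈ʳ : (u v w : V∞ X) → v ≈ w → u ∈ v → u ∈ w
∈-resp-≈ʳ u (_ , set _ f) (_ , set _ g) (p , _) (i , r) =
  let j , s = p i in j , ≈-trans u (_ , f i) (_ , g j) r s

elem-∈ : (w : V∞ X) (i : Elem w) → elem w i ∈ w
elem-∈ w i = i , ≈-refl (elem w i)

raise-≈ : (m≤n : m ℕ.≤ n) (v : V X m) → v ≈ᵥ raise m≤n v
raise-≈ _         (atom _)  = refl
raise-≈ (s≤s m≤n) (set _ f) =
  (λ i → i , raise-≈ m≤n (f i)) , (λ i → i , raise-≈ m≤n (f i))

-- Bounded formulas of the language of set theory, with de Bruijn indices:
-- a quantifier binds variable zero, which ranges over the elements of the
-- indicated outer variable.

data Formula (n : ℕ) : Set where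
  _≐̇_ _∈̇_     : Fin n → Fin n → Formula n
  ⊥̇           : Formula n
  _∧̇_ _∨̇_ _⇒̇_ : Formula n → Formula n → Formula n
  ∀̇ ∃̇         : Fin n → Formula (suc n) → Formula n

infix  9 _≐̇_ _∈̇_
infixr 8 _∧̇_
infixr 7 _∨̇_
infixr 6 _⇒̇_
infix  4 _⊨_

_⊨_ : Vec (V∞ X) n → Formula n → Set
ρ ⊨ i ≐̇ j   = lookup ρ i ≈ lookup ρ j
ρ ⊨ i ∈̇ j   = lookup ρ i ∈ lookup ρ j
ρ ⊨ ⊥̇       = ⊥
ρ ⊨ φ ∧̇ ψ   = ρ ⊨ φ × ρ ⊨ ψ
ρ ⊨ φ ∨̇ ψ   = ρ ⊨ φ ⊎ ρ ⊨ ψ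
ρ ⊨ φ ⇒̇ ψ   = ρ ⊨ φ → ρ ⊨ ψ
ρ ⊨ ∀̇ i φ   = ∀ e → elem (lookup ρ i) e ∷ ρ ⊨ φ
ρ ⊨ ∃̇ i φ   = ∃ λ e → elem (lookup ρ i) e ∷ ρ ⊨ φ

isUPair : (s x y : Fin n) → Formula n
isUPair s x y = x ∈̇ s ∧̇ y ∈̇ s ∧̇ ∀̇ s (zero ≐̇ suc x ∨̇ zero ≐̇ suc y)

isPair : (z x y : Fin n) → Formula n
isPair z x y = ∃̇ z (∃̇ (suc z)
  (isUPair (suc zero) (suc (suc x)) (suc (suc x)) ∧̇
   isUPair zero (suc (suc x)) (suc (suc y)) ∧̇
   isUPair (suc (suc z)) (suc zero) zero))

isTriple : (t x y z : Fin n) → Formula n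
isTriple t x y z = ∃̇ t (∃̇ zero
  (isPair zero (suc (suc y)) (suc (suc z)) ∧̇
   isPair (suc (suc t)) (suc (suc x)) zero))

upair-∈ˡ : (v w : V∞ X) → v ∈ upair v w
upair-∈ˡ (m , v) (n , w) = true , raise-≈ (ℕ.m≤m⊔n m n) v

upair-∈ʳ : (v w : V∞ X) → w ∈ upair v w
upair-∈ʳ (m , v) (n , w) = false , raise-≈ (ℕ.m≤n⊔m m n) w

∈-upair : (u v w : V∞ X) → u ∈ upair v w → u ≈ v ⊎ u ≈ w
∈-upair u (m , v) (n , w) (true  , p) = inj₁
  (≈-trans u (_ , raise (ℕ.m≤m⊔n m n) v) (m , v) p (≈ᵥ-sym v _ (raise-≈ _ v)))
∈-upair u (m , v) (n , w) (false , p) = inj₂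
  (≈-trans u (_ , raise (ℕ.m≤n⊔m m n) w) (n , w) p (≈ᵥ-sym w _ (raise-≈ _ w)))

≈-ext : (w w′ : V∞ X) → (∃ λ v → v ∈ w) → (∃ λ v → v ∈ w′) →
        (∀ e → elem w e ∈ w′) → (∀ e → elem w′ e ∈ w) → w ≈ w′
≈-ext (_ , set _ f) (_ , set _ g) _ _ p q =
  p , λ j → let i , r = q j in i , ≈ᵥ-sym (g j) (f i) r

⊨-isUPair : (ρ : Vec (V∞ X) n) (s x y : Fin n) →
            lookup ρ s ≈ upair (lookup ρ x) (lookup ρ y) → ρ ⊨ isUPair s x y
⊨-isUPair ρ s x y s≈ = back (upair-∈ˡ X′ Y) , back (upair-∈ʳ X′ Y) , λ e →
  ∈-upair (elem S e) X′ Y (∈-resp-≈ʳ (elem S e) S (upair X′ Y) s≈ (elem-∈ S e))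
  where
  S = lookup ρ s
  X′ = lookup ρ x
  Y = lookup ρ y
  back : ∀ {v} → v ∈ upair X′ Y → v ∈ S
  back {v} = ∈-resp-≈ʳ v (upair X′ Y) S (≈-sym S (upair X′ Y) s≈)

isUPair-⊨ : (ρ : Vec (V∞ X) n) (s x y : Fin n) →
            ρ ⊨ isUPair s x y → lookup ρ s ≈ upair (lookup ρ x) (lookup ρ y)
isUPair-⊨ ρ s x y (x∈s , y∈s , only) =
  ≈-ext S (upair X′ Y) (X′ , x∈s) (X′ , upair-∈ˡ X′ Y) to from
  where
  S = lookup ρ s
  X′ = lookup ρ x
  Y = lookup ρ y
  to : ∀ e → elem S e ∈ upair X′ Y
  to e with only e
  ... | inj₁ p = ∈-resp-≈ˡ X′ (elem S e) (upair X′ Y) (≈-sym (elem S e) X′ p) (upair-∈ˡ X′ Y)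
  ... | inj₂ p = ∈-resp-≈ˡ Y (elem S e) (upair X′ Y) (≈-sym (elem S e) Y p) (upair-∈ʳ X′ Y)
  from : ∀ e → elem (upair X′ Y) e ∈ S
  from e with ∈-upair (elem (upair X′ Y) e) X′ Y (elem-∈ (upair X′ Y) e)
  ... | inj₁ p = ∈-resp-≈ˡ X′ _ S (≈-sym (elem (upair X′ Y) e) X′ p) x∈s
  ... | inj₂ p = ∈-resp-≈ˡ Y _ S (≈-sym (elem (upair X′ Y) e) Y p) y∈s

upair-cong : (v v′ w w′ : V∞ X) → v ≈ v′ → w ≈ w′ → upair v w ≈ upair v′ w′
upair-cong v v′ w w′ p q =
  isUPair-⊨ (upair v w ∷ v′ ∷ w′ ∷ []) zero (suc zero) (suc (suc zero))
    ( ∈-resp-≈ˡ v v′ (upair v w) p (upair-∈ˡ v w)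
    , ∈-resp-≈ˡ w w′ (upair v w) q (upair-∈ʳ v w)
    , λ e → move e (∈-upair (elem (upair v w) e) v w (elem-∈ (upair v w) e)))
  where
  move : ∀ e → elem (upair v w) e ≈ v ⊎ elem (upair v w) e ≈ w →
         elem (upair v w) e ≈ v′ ⊎ elem (upair v w) e ≈ w′
  move e (inj₁ r) = inj₁ (≈-trans (elem (upair v w) e) v v′ r p)
  move e (inj₂ r) = inj₂ (≈-trans (elem (upair v w) e) w w′ r q)

⟨⟩-cong : (v v′ w w′ : V∞ X) → v ≈ v′ → w ≈ w′ → ⟨ v , w ⟩ ≈ ⟨ v′ , w′ ⟩
⟨⟩-cong v v′ w w′ p q =
  upair-cong (upair v v) (upair v′ v′) (upair v w) (upair v′ w′)
    (upair-cong v v′ v v′ p p) (upair-cong v v′ w w′ p q)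

⊨-isPair : (ρ : Vec (V∞ X) n) (z x y : Fin n) →
           lookup ρ z ≈ ⟨ lookup ρ x , lookup ρ y ⟩ → ρ ⊨ isPair z x y
⊨-isPair ρ z x y z≈ =
  let i , p = ∈-resp-≈ʳ XX (upair XX XY) Z Z≈ (upair-∈ˡ XX XY)
      j , q = ∈-resp-≈ʳ XY (upair XX XY) Z Z≈ (upair-∈ʳ XX XY)
      s = elem Z i ; t = elem Z j
      σ = t ∷ s ∷ ρ
  in i , j
   , ⊨-isUPair σ (suc zero) (suc (suc x)) (suc (suc x)) (≈-sym XX s p)
   , ⊨-isUPair σ zero (suc (suc x)) (suc (suc y)) (≈-sym XY t q)
   , ⊨-isUPair σ (suc (suc z)) (suc zero) zero
       (≈-trans Z (upair XX XY) (upair s t) z≈ (upair-cong XX s XY t p q))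
  where
  Z = lookup ρ z
  XX = upair (lookup ρ x) (lookup ρ x)
  XY = upair (lookup ρ x) (lookup ρ y)
  Z≈ = ≈-sym Z (upair XX XY) z≈

isPair-⊨ : (ρ : Vec (V∞ X) n) (z x y : Fin n) →
           ρ ⊨ isPair z x y → lookup ρ z ≈ ⟨ lookup ρ x , lookup ρ y ⟩
isPair-⊨ ρ z x y (i , j , p , q , r) =
  ≈-trans Z (upair s t) (upair XX XY)
    (isUPair-⊨ σ (suc (suc z)) (suc zero) zero r)
    (upair-cong s XX t XY
      (isUPair-⊨ σ (suc zero) (suc (suc x)) (suc (suc x)) p)
      (isUPair-⊨ σ zero (suc (suc x)) (suc (suc y)) q))
  where
  Z = lookup ρ z
  XX = upair (lookup ρ x) (lookup ρ x)
  XY = upair (lookup ρ x) (lookup ρ y)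
  s = elem Z i
  t = elem Z j
  σ = t ∷ s ∷ ρ

⊨-isTriple : (ρ : Vec (V∞ X) n) (t x y z : Fin n) →
             lookup ρ t ≈ ⟨ lookup ρ x , ⟨ lookup ρ y , lookup ρ z ⟩ ⟩ → ρ ⊨ isTriple t x y z
⊨-isTriple ρ t x y z t≈ =
  let i , p = ∈-resp-≈ʳ XQ (upair XX XQ) T T≈ (upair-∈ʳ XX XQ)
      c = elem T i
      j , q = ∈-resp-≈ʳ Q XQ c p (upair-∈ʳ X′ Q)
      e = elem c j
      σ = e ∷ c ∷ ρ
  in i , j
   , ⊨-isPair σ zero (suc (suc y)) (suc (suc z)) (≈-sym Q e q)
   , ⊨-isPair σ (suc (suc t)) (suc (suc x)) zero
       (≈-trans T ⟨ X′ , Q ⟩ ⟨ X′ , e ⟩ t≈ (⟨⟩-cong X′ X′ Q e (≈-refl X′) q))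
  where
  T = lookup ρ t
  X′ = lookup ρ x
  Q = ⟨ lookup ρ y , lookup ρ z ⟩
  XX = upair X′ X′
  XQ = upair X′ Q
  T≈ = ≈-sym T ⟨ X′ , Q ⟩ t≈

isTriple-⊨ : (ρ : Vec (V∞ X) n) (t x y z : Fin n) →
             ρ ⊨ isTriple t x y z → lookup ρ t ≈ ⟨ lookup ρ x , ⟨ lookup ρ y , lookup ρ z ⟩ ⟩
isTriple-⊨ ρ t x y z (i , j , p , q) =
  ≈-trans T ⟨ X′ , e ⟩ ⟨ X′ , Q ⟩
    (isPair-⊨ σ (suc (suc t)) (suc (suc x)) zero q)
    (⟨⟩-cong X′ X′ e Q (≈-refl X′) (isPair-⊨ σ zero (suc (suc y)) (suc (suc z)) p))
  where
  T = lookup ρ t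
  X′ = lookup ρ x
  Q = ⟨ lookup ρ y , lookup ρ z ⟩
  c = elem T i
  e = elem c j
  σ = e ∷ c ∷ ρ

record Language : Set where
  field
    #fun #rel : ℕ
    fun-arity : Fin #fun → ℕ
    rel-arity : Fin #rel → ℕ

module _ (L : Language) where
  open Language L

  data Term (n : ℕ) : Set where
    var : Fin n → Term n
    app : (f : Fin #fun) → Vec (Term n) (fun-arity f) → Term n

  data FO (n : ℕ) : Set where
    _≐′_           : Term n → Term n → FO n
    rel            : (r : Fin #rel) → Vec (Term n) (rel-arity r) → FO n
    ⊥′             : FO n
    _∧′_ _∨′_ _⇒′_ : FO n → FO n → FO n
    ∀′ ∃′          : FO (suc n) → FO n

-- *ℕ is the set of atoms of the target superstructure, and n : ℕ⁺ is
-- identified with the atom * at n.  The condition `proper` says that every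
-- infinite A ⊆ ℕ⁺ acquires a nonstandard element.

record NonstandardExtension (*ℕ : Set) : Set₁ where
  field
    *_       : V∞ ℕ⁺ → V∞ *ℕ
    *-base   : * base ℕ⁺ ≈ base *ℕ
    transfer : (φ : Formula n) (ρ : Vec (V∞ ℕ⁺) n) → ρ ⊨ φ ⇔ map *_ ρ ⊨ φ
    proper   : ∀ A → Infinite A → ∃ λ x → at x ∈ * ⌜ A ⌝ × ∀ n → ¬ (at x ≈ * at n)

module _ {*ℕ : Set} (ext : NonstandardExtension *ℕ) where
  open NonstandardExtension ext

  Internal : V∞ *ℕ → Set₁
  Internal v = ∃ λ a → v ∈ * a

  -- 𝔠⁺-saturation.  The map `code` into the power set of ℕ⁺ says that the
  -- family {F i} has at most 𝔠 members.
  Saturated : Set₂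
  Saturated =
    {I : Set₁} (F : I → V∞ *ℕ) (code : I → Subset) →
    (∀ i j → code i ≐ code j → F i ≈ F j) →
    (∀ i → Internal (F i)) →
    (∀ (is : List I) → ∃ λ v → All (λ i → v ∈ F i) is) →
    ∃ λ v → ∀ i → v ∈ F i

  module _ (L : Language) where
    open Language L

    -- An internally presented structure: the domain, the relations and the
    -- graphs of the functions are internal sets.
    record InternalStructure : Set₁ where
      field
        domain          : V∞ *ℕ
        domain-internal : Internal domain
        domain-nonempty : Elem domain

      ⟪_⟫ : Vec (Elem domain) k → V∞ *ℕ
      ⟪ ds ⟫ = tuple (map (elem domain) ds)

      field
        relation          : Fin #rel → V∞ *ℕ
        relation-internal : ∀ r → Internal (relation r)
        relation-isSet    : ∀ r → ¬ (∃ λ x → relation r ≈ at x)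
        relation-⊆        : ∀ r v → v ∈ relation r →
                            ∃ λ (ds : Vec (Elem domain) (rel-arity r)) → v ≈ ⟪ ds ⟫
        function          : Fin #fun → V∞ *ℕ
        function-internal : ∀ f → Internal (function f)
        function-⊆        : ∀ f v → v ∈ function f →
                            ∃ λ (ds : Vec (Elem domain) (suc (fun-arity f))) → v ≈ ⟪ ds ⟫
        function-total    : ∀ f (ds : Vec (Elem domain) (fun-arity f)) →
                            ∃ λ e → ⟪ ds ∷ʳ e ⟫ ∈ function f
        function-unique   : ∀ f (ds : Vec (Elem domain) (fun-arity f)) e e′ →
                            ⟪ ds ∷ʳ e ⟫ ∈ function f → ⟪ ds ∷ʳ e′ ⟫ ∈ function f →
                            elem domain e ≈ elem domain e′

      setoid : Setoid 0ℓ 0ℓ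
      setoid = record
        { Carrier       = Elem domain
        ; _≈_           = λ d e → elem domain d ≈ elem domain e
        ; isEquivalence = record
          { refl  = λ {d} → ≈-refl (elem domain d)
          ; sym   = λ {d} {e} → ≈-sym (elem domain d) (elem domain e)
          ; trans = λ {c} {d} {e} → ≈-trans (elem domain c) (elem domain d) (elem domain e)
          }
        }

      eval  : Vec (Elem domain) n → Term L n → Elem domain
      evals : Vec (Elem domain) n → Vec (Term L n) k → Vec (Elem domain) k
      eval η (var i)    = lookup η i
      eval η (app f ts) = proj₁ (function-total f (evals η ts))
      evals η []        = []
      evals η (t ∷ ts)  = eval η t ∷ evals η ts

      satisfies : Vec (Elem domain) n → FO L n → Set
      satisfies η (s ≐′ t)   = elem domain (eval η s) ≈ elem domain (eval η t)
      satisfies η (rel r ts) = ⟪ evals η ts ⟫ ∈ relation r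
      satisfies η ⊥′         = ⊥
      satisfies η (φ ∧′ ψ)   = satisfies η φ × satisfies η ψ
      satisfies η (φ ∨′ ψ)   = satisfies η φ ⊎ satisfies η ψ
      satisfies η (φ ⇒′ ψ)   = satisfies η φ → satisfies η ψ
      satisfies η (∀′ φ)     = ∀ d → satisfies (d ∷ η) φ
      satisfies η (∃′ φ)     = ∃ λ d → satisfies (d ∷ η) φ

    open InternalStructure

    ElementarilyEquivalent : InternalStructure → InternalStructure → Set
    ElementarilyEquivalent 𝔄 𝔅 = ∀ φ → satisfies 𝔄 [] φ ⇔ satisfies 𝔅 [] φ

    record Isomorphism (𝔄 𝔅 : InternalStructure) : Set where
      field
        bijection : Bijection (setoid 𝔄) (setoid 𝔅)
      open Bijection bijection using (to)
      field
        preserves-rel : ∀ r (ds : Vec (Elem (domain 𝔄)) (rel-arity r)) →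
          ⟪ 𝔄 ⟫ ds ∈ relation 𝔄 r ⇔ ⟪ 𝔅 ⟫ (map to ds) ∈ relation 𝔅 r
        preserves-fun : ∀ f (ds : Vec (Elem (domain 𝔄)) (fun-arity f)) e →
          ⟪ 𝔄 ⟫ (ds ∷ʳ e) ∈ function 𝔄 f ⇔ ⟪ 𝔅 ⟫ (map to ds ∷ʳ to e) ∈ function 𝔅 f

  HensonIP : Set₁
  HensonIP = (L : Language) (𝔄 𝔅 : InternalStructure L) →
             ElementarilyEquivalent L 𝔄 𝔅 → Isomorphism L 𝔄 𝔅

  *-total : (f : ℕ⁺ → ℕ⁺ → ℕ⁺) (x y : *ℕ) →
            ∃ λ z → ⟨ at x , ⟨ at y , at z ⟩ ⟩ ∈ * graph f
  *-total f x y =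
    let i , p = inBase x
        j , q = inBase y
        k , l , r = Equivalence.to (transfer φ ρ) total i j
        x′ = elem (* base ℕ⁺) i ; y′ = elem (* base ℕ⁺) j ; z′ = elem (* base ℕ⁺) k
        t = elem (* graph f) l
        z , s = ∈-resp-≈ʳ z′ (* base ℕ⁺) (base *ℕ) *-base (elem-∈ (* base ℕ⁺) k)
        v = ⟨ at x , ⟨ at y , at z ⟩ ⟩ ; v′ = ⟨ x′ , ⟨ y′ , z′ ⟩ ⟩
        v≈v′ = ⟨⟩-cong (at x) x′ ⟨ at y , at z ⟩ ⟨ y′ , z′ ⟩ p
                 (⟨⟩-cong (at y) y′ (at z) z′ q (≈-sym z′ (at z) s))
        t≈v′ = isTriple-⊨ (t ∷ z′ ∷ y′ ∷ x′ ∷ map *_ ρ)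
                 zero (suc (suc (suc zero))) (suc (suc zero)) (suc zero) r
    in z , l , ≈-trans v v′ t v≈v′ (≈-sym t v′ t≈v′)
    where
    ρ = base ℕ⁺ ∷ graph f ∷ []
    φ : Formula 2
    φ = ∀̇ zero (∀̇ (suc zero) (∃̇ (suc (suc zero)) (∃̇ (suc (suc (suc (suc zero))))
          (isTriple zero (suc (suc (suc zero))) (suc (suc zero)) (suc zero)))))
    inBase : ∀ x → at x ∈ * base ℕ⁺
    inBase x = ∈-resp-≈ʳ (at x) (base *ℕ) (* base ℕ⁺)
                 (≈-sym (* base ℕ⁺) (base *ℕ) *-base) (x , refl)
    total : ρ ⊨ φ
    total a b = f a b , (a , b) ,
      ⊨-isTriple (elem (graph f) (a , b) ∷ at (f a b) ∷ at b ∷ at a ∷ ρ)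
        zero (suc (suc (suc zero))) (suc (suc zero)) (suc zero)
        (≈-refl ⟨ at a , ⟨ at b , at (f a b) ⟩ ⟩)

  -- The extension *f of a binary operation f: its graph is the extension
  -- of the graph of f.
  lift₂ : (ℕ⁺ → ℕ⁺ → ℕ⁺) → *ℕ → *ℕ → *ℕ
  lift₂ f x y = proj₁ (*-total f x y)

  _*·_ _*^_ : *ℕ → *ℕ → *ℕ
  _*·_ = lift₂ _·_
  _*^_ = lift₂ _^_

  _*∣_ : *ℕ → *ℕ → Set
  x *∣ y = ⟨ at x , at y ⟩ ∈ * ⌜ _∣_ ⌝₂

  Star : Subset → Pred *ℕ 0ℓ
  Star A x = at x ∈ * ⌜ A ⌝

  tp : *ℕ → βℕ
  tp x = record
    { _∋_      = λ A → Star A x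
    ; ∋-whole  = ∋-U
    ; ∌-empty  = λ (e , _) → Equivalence.to
        (transfer (∀̇ zero ⊥̇) (⌜ ∅ ⌝ ∷ [])) (λ ()) e
    ; ∋-upward = λ {A} {B} A⊆B (e , p) →
        ∈-resp-≈ˡ (elem (* ⌜ A ⌝) e) (at x) (* ⌜ B ⌝) (≈-sym (at x) _ p)
          (Equivalence.to (transfer (∀̇ zero (zero ∈̇ suc (suc zero))) (⌜ A ⌝ ∷ ⌜ B ⌝ ∷ []))
            (λ (n , n∈A) → (n , A⊆B n∈A) , refl) e)
    ; ∋-∩      = λ {A} {B} (e , p) x∈B →
        ∈-resp-≈ˡ (elem (* ⌜ A ⌝) e) (at x) (* ⌜ A ∩ B ⌝) (≈-sym (at x) _ p)
          (Equivalence.to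
            (transfer (∀̇ zero (zero ∈̇ suc (suc zero) ⇒̇ zero ∈̇ suc (suc (suc zero))))
              (⌜ A ⌝ ∷ ⌜ B ⌝ ∷ ⌜ A ∩ B ⌝ ∷ []))
            (λ { (n , n∈A) ((.n , n∈B) , refl) → (n , n∈A , n∈B) , refl }) e
            (∈-resp-≈ˡ (at x) (elem (* ⌜ A ⌝) e) (* ⌜ B ⌝) p x∈B))
    ; ∋-ultra  = λ A x∉A → let e , p = ∋-U in
        ∈-resp-≈ˡ (elem (* ⌜ U ⌝) e) (at x) (* ⌜ ∁ A ⌝) (≈-sym (at x) _ p)
          (Equivalence.to
            (transfer (∀̇ zero ((zero ∈̇ suc (suc zero) ⇒̇ ⊥̇) ⇒̇ zero ∈̇ suc (suc (suc zero))))
              (⌜ U ⌝ ∷ ⌜ A ⌝ ∷ ⌜ ∁ A ⌝ ∷ []))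
            (λ (n , _) n∉A → (n , λ n∈A → n∉A ((n , n∈A) , refl)) , refl) e
            (x∉A ∘ ∈-resp-≈ˡ (elem (* ⌜ U ⌝) e) (at x) (* ⌜ A ⌝) (≈-sym (at x) _ p)))
    }
    where
    ∋-U : Star U x
    ∋-U = ∈-resp-≈ʳ (at x) (* base ℕ⁺) (* ⌜ U ⌝)
      (Equivalence.to (transfer (zero ≐̇ suc zero) (base ℕ⁺ ∷ ⌜ U ⌝ ∷ []))
        ((λ n → (n , tt) , refl) , (λ (n , _) → n , refl)))
      (∈-resp-≈ʳ (at x) (base *ℕ) (* base ℕ⁺)
        (≈-sym (* base ℕ⁺) (base *ℕ) *-base) (x , refl))

  infix 4 _generates_

  _generates_ : *ℕ → βℕ → Set₁
  x generates F = ∀ A → tp x ∋ A ⇔ F ∋ A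

  ExactFactor : *ℕ → Pred *ℕ 0ℓ
  ExactFactor x y = ∃₂ λ p a → Star ℙ p × y ≡ p *^ a ×
    ∃ λ x′ → x ≡ y *· x′ × ¬ (p *∣ x′)

  module BasicClass (𝒫 : βℕ) where

    Pairs : Set₁
    Pairs = (∃ λ p → p generates 𝒫) × *ℕ

    power : Pairs → *ℕ
    power ((p , _) , a) = p *^ a

    _≈𝒫_ : Pairs → Pairs → Set₁
    s ≈𝒫 t = tp (power s) =~ tp (power t)

    -- u ∈ 𝓔_𝒫, with u given by its characteristic predicate.
    IsClass : Pred (Pred Pairs (lsuc 0ℓ)) (lsuc 0ℓ)
    IsClass u = ∃ λ s → ∀ t → u t ⇔ t ≈𝒫 s

    -- The basic class 𝒫ᵘ, with ultrafilters compared by their members.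
    basicClass : Pred Pairs (lsuc 0ℓ) → Pred βℕ (lsuc 0ℓ)
    basicClass u F = ∃ λ s → u s × power s generates F

  GeneratorOf : Pred βℕ (lsuc 0ℓ) → Pred *ℕ (lsuc 0ℓ)
  GeneratorOf 𝒦 y = ∃ λ F → 𝒦 F × y generates F

infix 4 _∈ᵇ_

_∈ᵇ_ : Subset → Pred βℕ (lsuc 0ℓ) → Set₁
A ∈ᵇ 𝒦 = ∀ F → 𝒦 F → F ∋ A

-- Given finitely many elements ys, the sets D_A of the exact factors of x that
-- lie in *A and not among ys, for A in 𝒫ᵘ ∩ 𝒞, are internal by transfer of
-- comprehension.  They have the finite intersection property, because 𝒫ᵘ ∩ 𝒞
-- is closed under finite intersections.  Saturation yields a common element
-- z = p^a.  The sets {qⁿ : q ∈ B} with B ∈ 𝒫 are in 𝒫ᵘ ∩ 𝒞 and force p ⊨ 𝒫; for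
-- B ∈ 𝒰, whichever of ℙexp ∩ B and ℙexp ∩ ∁ B belongs to 𝒫ᵘ is convex, and these
-- sets force tp(z) =~ tp(q^b) for q^b a generator of 𝒫ᵘ.

module Submission where

open import Defs
open import Axiom.ExcludedMiddle using (ExcludedMiddle)
open import Level using (0ℓ) renaming (suc to lsuc)
open import Relation.Unary using (Pred; _∩_; _≐_; _⊆_; U; ∁; Satisfiable)

open import Data.Bool.Base using (Bool; true)
open import Data.Empty using (⊥-elim)
open import Data.Fin.Base using (Fin; zero; suc)
open import Data.Irrelevant using ([_])
open import Data.List.Base using (List; []; _∷_)
import Data.List.Membership.Propositional as List
open import Data.List.Relation.Unary.All as All using (All; []; _∷_)
open import Data.List.Relation.Unary.Any using (here; there)
open import Data.Nat.Base as ℕ using (ℕ; zero; suc)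
import Data.Nat.Coprimality as ℕ
import Data.Nat.Divisibility as ℕ
import Data.Nat.Primality as ℕ
import Data.Nat.Properties as ℕ
open import Data.Product using (∃; ∃₂; _×_; _,_; proj₁; proj₂)
open import Data.Refinement using (_,_; value; value-injective)
open import Data.Sum.Base using (_⊎_; inj₁; inj₂)
import Data.Sum.Base as Sum
open import Data.Vec.Base using (Vec; []; _∷_; lookup; map)
open import Function.Base using (_∘_; id)
open import Function.Bundles using (_⇔_; mk⇔; module Equivalence)
open import Relation.Binary.PropositionalEquality using (_≡_; refl; sym; trans; cong; cong₂; subst)
open import Relation.Nullary using (¬_; Dec; yes; no; does; contradiction)
open import Relation.Nullary.Decidable using (decidable-stable)

private variable
  X : Set
  m n : ℕ

-- Prime powers

prime∣^⇒≡ : ∀ {p q} → ℕ.Prime p → ℕ.Prime q → ∀ k → p ℕ.∣ q ℕ.^ k → p ≡ q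
prime∣^⇒≡ pp pq zero p∣1 = contradiction (subst ℕ.Prime (ℕ.∣1⇒≡1 p∣1) pp) ℕ.¬prime[1]
prime∣^⇒≡ {q = q} pp pq (suc k) p∣q^k with ℕ.euclidsLemma q (q ℕ.^ k) pp p∣q^k
... | inj₂ p∣q^k = prime∣^⇒≡ pp pq k p∣q^k
... | inj₁ p∣q with ℕ.prime⇒irreducible pq p∣q
...   | inj₁ refl = contradiction pp ℕ.¬prime[1]
...   | inj₂ p≡q  = p≡q

-- Induction on the exponent. If p divides c, one factor p is cancelled on both sides; otherwise c
-- is coprime to p and already divides the lower power.
∣prime^⇒prime^ : ∀ {p c} → ℕ.Prime p → ∀ k → c ℕ.∣ p ℕ.^ k → ∃ λ j → c ≡ p ℕ.^ j
∣prime^⇒prime^ pp zero c∣1 = 0 , ℕ.∣1⇒≡1 c∣1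
∣prime^⇒prime^ {p} {c} pp (suc k) c∣p^k with p ℕ.∣? c
... | yes (ℕ.divides c′ refl) =
  let j , eq = ∣prime^⇒prime^ pp k (ℕ.*-cancelˡ-∣ p {{ℕ.prime⇒nonZero pp}}
                 (subst (ℕ._∣ p ℕ.^ suc k) (ℕ.*-comm c′ p) c∣p^k))
  in suc j , trans (ℕ.*-comm c′ p) (cong (p ℕ.*_) eq)
... | no p∤c = ∣prime^⇒prime^ pp k (ℕ.coprime-divisor coprime c∣p^k)
  where
  coprime : ℕ.Coprime c p
  coprime (d∣c , d∣p) with ℕ.prime⇒irreducible pp d∣p
  ... | inj₁ d≡1  = d≡1
  ... | inj₂ refl = contradiction d∣c p∤c

-- Exponents are positive, so 1 is left out; otherwise it could belong to the sets of both `B` and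
-- `∁ B`.
PrimePowers : Subset → Subset
PrimePowers B m = ∃₂ λ p n → (ℙ p × B p) × m ≡ p ^ n

PrimePowers⊆ℙexp : ∀ {B} → PrimePowers B ⊆ ℙexp
PrimePowers⊆ℙexp (p , n , (pp , _) , eq) = p , n , pp , eq

ℙexp⊆PrimePowers : ℙexp ⊆ PrimePowers U
ℙexp⊆PrimePowers (p , n , pp , eq) = p , n , (pp , _) , eq

-- Since p divides p^(k+1) = q^n, the two prime bases coincide.
PrimePowers-disjoint : ∀ {B m} → PrimePowers B m → ¬ PrimePowers (∁ B) m
PrimePowers-disjoint {B} (p , (suc k , _) , (pp , Bp) , refl) (q , (n , _) , (pq , ¬Bq) , eq) =
  ¬Bq (subst B (value-injective p≡q) Bp)
  where
  p≡q : value p ≡ value q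
  p≡q = prime∣^⇒≡ pp pq n (subst (value p ℕ.∣_) (cong value eq) (ℕ.m∣m*n (value p ℕ.^ k)))
PrimePowers-disjoint (_ , (zero , [ () ]) , _) _

ℙexp≢1 : ∀ {m} → ℙexp m → ¬ value m ≡ 1
ℙexp≢1 (_ , (zero , [ () ]) , _)
ℙexp≢1 (p , (suc k , _) , pp , refl) eq =
  ℕ.¬prime[1] (subst ℕ.Prime (ℕ.m*n≡1⇒m≡1 (value p) (value p ℕ.^ k) eq) pp)

-- A divisor c of p^n is a power of the same p. Its exponent is not 0, because a ∣ 1 would make the
-- prime power a equal to 1.
PrimePowers-convex : ∀ {B} → Convex (PrimePowers B)
PrimePowers-convex {c = c} Aa (p , (n , _) , pp , refl) a∣c c∣b with ∣prime^⇒prime^ (proj₁ pp) n c∣b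
... | zero  , refl = contradiction (ℕ.∣1⇒≡1 a∣c) (ℙexp≢1 (PrimePowers⊆ℙexp Aa))
... | suc j , eq   = p , (suc j , [ _ ]) , pp , value-injective eq

ℙexp-convex : Convex ℙexp
ℙexp-convex Aa Ab a∣c c∣b =
  PrimePowers⊆ℙexp (PrimePowers-convex (ℙexp⊆PrimePowers Aa) (ℙexp⊆PrimePowers Ab) a∣c c∣b)

∩-convex : ∀ {A B} → Convex A → Convex B → Convex (A ∩ B)
∩-convex cA cB (Aa , Ba) (Ab , Bb) a∣c c∣b = cA Aa Ab a∣c c∣b , cB Ba Bb a∣c c∣b

-- The lower endpoint suffices, by upward closure.
𝒰-convex : ∀ {A} → 𝒰 A → Convex A
𝒰-convex (_ , _ , A↑⊆A) Aa _ a∣c _ = A↑⊆A (_ , Aa , a∣c)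

-- The complement is closed under divisors, so the upper endpoint suffices.
𝒰-∁-convex : ∀ {A} → 𝒰 A → Convex (∁ A)
𝒰-∁-convex (_ , _ , A↑⊆A) _ ¬Ab _ c∣b Ac = ¬Ab (A↑⊆A (_ , Ac , c∣b))

-- Pairs in the superstructure

∈-singleton : (u v : V∞ X) → u ∈ upair v v → u ≈ v
∈-singleton u v = Sum.reduce ∘ ∈-upair u v v

upair-singleton : (u v w : V∞ X) → upair u v ≈ upair w w → u ≈ w × v ≈ w
upair-singleton u v w eq =
  ∈-singleton u w (∈-resp-≈ʳ u (upair u v) (upair w w) eq (upair-∈ˡ u v)) ,
  ∈-singleton v w (∈-resp-≈ʳ v (upair u v) (upair w w) eq (upair-∈ʳ u v))

-- Each of v and w is an element of the other pair. Unless this already gives the equality, both are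
-- equal to u.
upair-cancelˡ : (u v w : V∞ X) → upair u v ≈ upair u w → v ≈ w
upair-cancelˡ u v w eq = cases
  (∈-upair v u w (∈-resp-≈ʳ v (upair u v) (upair u w) eq (upair-∈ʳ u v)))
  (∈-upair w u v (∈-resp-≈ʳ w (upair u w) (upair u v) (≈-sym (upair u v) (upair u w) eq) (upair-∈ʳ u w)))
  where
  cases : v ≈ u ⊎ v ≈ w → w ≈ u ⊎ w ≈ v → v ≈ w
  cases (inj₂ v≈w) _          = v≈w
  cases (inj₁ _)   (inj₂ w≈v) = ≈-sym w v w≈v
  cases (inj₁ v≈u) (inj₁ w≈u) = ≈-trans v u w v≈u (≈-sym w u w≈u)

-- The singleton of v equals one of the two elements of the right-hand Kuratowski pair, and v′ lies
-- in both of these.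
⟨⟩-injectiveˡ : (v v′ w w′ : V∞ X) → ⟨ v , w ⟩ ≈ ⟨ v′ , w′ ⟩ → v ≈ v′
⟨⟩-injectiveˡ v v′ w w′ eq = Sum.[ proj₁ ∘ upair-singleton v v v′
  , (λ p → ≈-sym v′ v (proj₁ (upair-singleton v′ w′ v (≈-sym (upair v v) (upair v′ w′) p)))) ]
  (∈-upair (upair v v) (upair v′ v′) (upair v′ w′)
    (∈-resp-≈ʳ (upair v v) ⟨ v , w ⟩ ⟨ v′ , w′ ⟩ eq (upair-∈ˡ (upair v v) (upair v w))))

-- Once v′ is replaced by v, the common component cancels twice.
⟨⟩-injectiveʳ : (v v′ w w′ : V∞ X) → ⟨ v , w ⟩ ≈ ⟨ v′ , w′ ⟩ → w ≈ w′
⟨⟩-injectiveʳ v v′ w w′ eq = upair-cancelˡ v w w′ (upair-cancelˡ (upair v v) (upair v w) (upair v w′)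
  (≈-trans ⟨ v , w ⟩ ⟨ v′ , w′ ⟩ ⟨ v , w′ ⟩ eq (⟨⟩-cong v′ v w′ w′ v′≈v (≈-refl w′))))
  where
  v′≈v : v′ ≈ v
  v′≈v = ≈-sym v v′ (⟨⟩-injectiveˡ v v′ w w′ eq)

∈-⌜⌝ : {A : Pred X 0ℓ} {x : X} → at x ∈ ⌜ A ⌝ → A x
∈-⌜⌝ ((_ , Ax) , refl) = Ax

⌜⌝-∈ : {A : Pred X 0ℓ} {x : X} → A x → at x ∈ ⌜ A ⌝
⌜⌝-∈ {x = x} Ax = (x , Ax) , refl

⌜⌝-elements : {A : Pred X 0ℓ} (v : V∞ X) → v ∈ ⌜ A ⌝ → ∃ λ x → v ≈ at x × A x
⌜⌝-elements v ((x , Ax) , v≈x) = x , v≈x , Ax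

⌜⌝-cong : {A B : Pred X 0ℓ} → A ≐ B → ⌜ A ⌝ ≈ ⌜ B ⌝
⌜⌝-cong (A⊆B , B⊆A) = (λ (x , Ax) → (x , A⊆B Ax) , refl) , (λ (x , Bx) → (x , B⊆A Bx) , refl)

∈-graph : (f : X → X → X) {x y z : X} → ⟨ at x , ⟨ at y , at z ⟩ ⟩ ∈ graph f → z ≡ f x y
∈-graph f {x} {y} {z} ((a , b) , eq) = trans z≡fab (sym (cong₂ f x≡a y≡b))
  where
  x≡a : x ≡ a
  x≡a = ⟨⟩-injectiveˡ (at x) (at a) ⟨ at y , at z ⟩ ⟨ at b , at (f a b) ⟩ eq
  yz≈ : ⟨ at y , at z ⟩ ≈ ⟨ at b , at (f a b) ⟩
  yz≈ = ⟨⟩-injectiveʳ (at x) (at a) ⟨ at y , at z ⟩ ⟨ at b , at (f a b) ⟩ eq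
  y≡b : y ≡ b
  y≡b = ⟨⟩-injectiveˡ (at y) (at b) (at z) (at (f a b)) yz≈
  z≡fab : z ≡ f a b
  z≡fab = ⟨⟩-injectiveʳ (at y) (at b) (at z) (at (f a b)) yz≈

-- Bounded formulas

pattern v0 = zero
pattern v1 = suc v0
pattern v2 = suc v1
pattern v3 = suc v2
pattern v4 = suc v3
pattern v5 = suc v4
pattern v6 = suc v5
pattern v7 = suc v6
pattern v8 = suc v7
pattern v9 = suc v8

hasPair : (r x y : Fin n) → Formula n
hasPair r x y = ∃̇ r (isPair zero (suc x) (suc y))

hasTriple : (r x y z : Fin n) → Formula n
hasTriple r x y z = ∃̇ r (isTriple zero (suc x) (suc y) (suc z))

⊨-hasPair : (ρ : Vec (V∞ X) n) (r x y : Fin n) →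
          ρ ⊨ hasPair r x y ⇔ ⟨ lookup ρ x , lookup ρ y ⟩ ∈ lookup ρ r
⊨-hasPair ρ r x y = mk⇔
  (λ (e , p) → e , ≈-sym (elem R e) P (isPair-⊨ (elem R e ∷ ρ) zero (suc x) (suc y) p))
  (λ (e , p) → e , ⊨-isPair (elem R e ∷ ρ) zero (suc x) (suc y) (≈-sym P (elem R e) p))
  where
  R = lookup ρ r
  P = ⟨ lookup ρ x , lookup ρ y ⟩

⊨-hasTriple : (ρ : Vec (V∞ X) n) (r x y z : Fin n) →
            ρ ⊨ hasTriple r x y z ⇔ ⟨ lookup ρ x , ⟨ lookup ρ y , lookup ρ z ⟩ ⟩ ∈ lookup ρ r
⊨-hasTriple ρ r x y z = mk⇔
  (λ (e , p) → e , ≈-sym (elem R e) P (isTriple-⊨ (elem R e ∷ ρ) zero (suc x) (suc y) (suc z) p))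
  (λ (e , p) → e , ⊨-isTriple (elem R e ∷ ρ) zero (suc x) (suc y) (suc z) (≈-sym P (elem R e) p))
  where
  R = lookup ρ r
  P = ⟨ lookup ρ x , ⟨ lookup ρ y , lookup ρ z ⟩ ⟩

lift : (Fin m → Fin n) → Fin (suc m) → Fin (suc n)
lift r zero    = zero
lift r (suc i) = suc (r i)

rename : (Fin m → Fin n) → Formula m → Formula n
rename r (i ≐̇ j) = r i ≐̇ r j
rename r (i ∈̇ j) = r i ∈̇ r j
rename r ⊥̇       = ⊥̇
rename r (φ ∧̇ ψ) = rename r φ ∧̇ rename r ψ
rename r (φ ∨̇ ψ) = rename r φ ∨̇ rename r ψ
rename r (φ ⇒̇ ψ) = rename r φ ⇒̇ rename r ψ
rename r (∀̇ i φ) = ∀̇ (r i) (rename (lift r) φ)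
rename r (∃̇ i φ) = ∃̇ (r i) (rename (lift r) φ)

-- Agreement is up to `≈`, because an element of a set reappears in another presentation of that set
-- only up to `≈`.
Matches : Vec (V∞ X) m → Vec (V∞ X) n → (Fin m → Fin n) → Set
Matches ρ σ r = ∀ i → lookup ρ i ≈ lookup σ (r i)

lift-Matches : {ρ : Vec (V∞ X) m} {σ : Vec (V∞ X) n} {r : Fin m → Fin n} (v w : V∞ X) →
               v ≈ w → Matches ρ σ r → Matches (v ∷ ρ) (w ∷ σ) (lift r)
lift-Matches v w v≈w ρ~σ zero    = v≈w
lift-Matches v w v≈w ρ~σ (suc i) = ρ~σ i

elem-resp-≈ : (v w : V∞ X) → v ≈ w → ∀ e → elem v e ∈ w
elem-resp-≈ v w v≈w e = ∈-resp-≈ʳ (elem v e) v w v≈w (elem-∈ v e)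

-- At a quantifier the index is carried over to the other presentation of the bounding set. The two
-- directions call each other because implication is contravariant on the left.
⊨-rename : (ρ : Vec (V∞ X) m) (σ : Vec (V∞ X) n) (r : Fin m → Fin n) → Matches ρ σ r →
           ∀ φ → ρ ⊨ φ ⇔ σ ⊨ rename r φ
⊨-rename ρ σ r ρ~σ φ = mk⇔ (to ρ σ r ρ~σ φ) (from ρ σ r ρ~σ φ)
  where
  to : (ρ : Vec (V∞ X) m) (σ : Vec (V∞ X) n) (r : Fin m → Fin n) → Matches ρ σ r →
       ∀ φ → ρ ⊨ φ → σ ⊨ rename r φ
  from : (ρ : Vec (V∞ X) m) (σ : Vec (V∞ X) n) (r : Fin m → Fin n) → Matches ρ σ r →
         ∀ φ → σ ⊨ rename r φ → ρ ⊨ φ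
  to ρ σ r ρ~σ (i ≐̇ j) p =
    ≈-trans σi ρi σj (≈-sym ρi σi (ρ~σ i)) (≈-trans ρi ρj σj p (ρ~σ j))
    where
    ρi = lookup ρ i ; ρj = lookup ρ j ; σi = lookup σ (r i) ; σj = lookup σ (r j)
  to ρ σ r ρ~σ (i ∈̇ j) p = ∈-resp-≈ˡ ρi σi σj (ρ~σ i) (∈-resp-≈ʳ ρi ρj σj (ρ~σ j) p)
    where
    ρi = lookup ρ i ; ρj = lookup ρ j ; σi = lookup σ (r i) ; σj = lookup σ (r j)
  to ρ σ r ρ~σ (φ ∧̇ ψ) (p , q)  = to ρ σ r ρ~σ φ p , to ρ σ r ρ~σ ψ q
  to ρ σ r ρ~σ (φ ∨̇ ψ) (inj₁ p) = inj₁ (to ρ σ r ρ~σ φ p)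
  to ρ σ r ρ~σ (φ ∨̇ ψ) (inj₂ p) = inj₂ (to ρ σ r ρ~σ ψ p)
  to ρ σ r ρ~σ (φ ⇒̇ ψ) p        = to ρ σ r ρ~σ ψ ∘ p ∘ from ρ σ r ρ~σ φ
  to ρ σ r ρ~σ (∀̇ i φ) p e =
    let ρi = lookup ρ i ; σi = lookup σ (r i)
        d , e≈d = elem-resp-≈ σi ρi (≈-sym ρi σi (ρ~σ i)) e
    in to _ _ _ (lift-Matches {ρ = ρ} {σ} (elem ρi d) (elem σi e)
         (≈-sym (elem σi e) (elem ρi d) e≈d) ρ~σ) φ (p d)
  to ρ σ r ρ~σ (∃̇ i φ) (d , p) =
    let ρi = lookup ρ i ; σi = lookup σ (r i)
        e , d≈e = elem-resp-≈ ρi σi (ρ~σ i) d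
    in e , to _ _ _ (lift-Matches {ρ = ρ} {σ} (elem ρi d) (elem σi e) d≈e ρ~σ) φ p
  from ρ σ r ρ~σ (i ≐̇ j) p =
    ≈-trans ρi σi ρj (ρ~σ i) (≈-trans σi σj ρj p (≈-sym ρj σj (ρ~σ j)))
    where
    ρi = lookup ρ i ; ρj = lookup ρ j ; σi = lookup σ (r i) ; σj = lookup σ (r j)
  from ρ σ r ρ~σ (i ∈̇ j) p = ∈-resp-≈ˡ σi ρi ρj (≈-sym ρi σi (ρ~σ i))
    (∈-resp-≈ʳ σi σj ρj (≈-sym ρj σj (ρ~σ j)) p)
    where
    ρi = lookup ρ i ; ρj = lookup ρ j ; σi = lookup σ (r i) ; σj = lookup σ (r j)
  from ρ σ r ρ~σ (φ ∧̇ ψ) (p , q)  = from ρ σ r ρ~σ φ p , from ρ σ r ρ~σ ψ q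
  from ρ σ r ρ~σ (φ ∨̇ ψ) (inj₁ p) = inj₁ (from ρ σ r ρ~σ φ p)
  from ρ σ r ρ~σ (φ ∨̇ ψ) (inj₂ p) = inj₂ (from ρ σ r ρ~σ ψ p)
  from ρ σ r ρ~σ (φ ⇒̇ ψ) p        = from ρ σ r ρ~σ ψ ∘ p ∘ to ρ σ r ρ~σ φ
  from ρ σ r ρ~σ (∀̇ i φ) p d =
    let ρi = lookup ρ i ; σi = lookup σ (r i)
        e , d≈e = elem-resp-≈ ρi σi (ρ~σ i) d
    in from _ _ _ (lift-Matches {ρ = ρ} {σ} (elem ρi d) (elem σi e) d≈e ρ~σ) φ (p e)
  from ρ σ r ρ~σ (∃̇ i φ) (e , p) =
    let ρi = lookup ρ i ; σi = lookup σ (r i)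
        d , e≈d = elem-resp-≈ σi ρi (≈-sym ρi σi (ρ~σ i)) e
    in d , from _ _ _ (lift-Matches {ρ = ρ} {σ} (elem ρi d) (elem σi e)
         (≈-sym (elem σi e) (elem ρi d) e≈d) ρ~σ) φ p

⊨-resp-≈ : (v w : V∞ X) (ρ : Vec (V∞ X) n) → v ≈ w → ∀ φ → v ∷ ρ ⊨ φ → w ∷ ρ ⊨ φ
⊨-resp-≈ v w ρ v≈w φ p =
  -- `rename id φ` need not be `φ` definitionally, so it is entered from `v ∷ ρ` and left again
  -- within `w ∷ ρ`.
  Equivalence.from (⊨-rename (w ∷ ρ) (w ∷ ρ) id (λ i → ≈-refl (lookup (w ∷ ρ) i)) φ)
    (Equivalence.to (⊨-rename (v ∷ ρ) (w ∷ ρ) id v∷ρ~w∷ρ φ) p)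
  where
  v∷ρ~w∷ρ : Matches (v ∷ ρ) (w ∷ ρ) id
  v∷ρ~w∷ρ zero    = v≈w
  v∷ρ~w∷ρ (suc i) = ≈-refl (lookup ρ i)

-- A quantifier ranges over the indices of a presentation; this instantiates it at anything `≈` to
-- one of the elements.
∀̇-elim : (ρ : Vec (V∞ X) n) (i : Fin n) (φ : Formula (suc n)) (v : V∞ X) →
         v ∈ lookup ρ i → ρ ⊨ ∀̇ i φ → v ∷ ρ ⊨ φ
∀̇-elim ρ i φ v (e , v≈e) p =
  ⊨-resp-≈ (elem (lookup ρ i) e) v ρ (≈-sym v (elem (lookup ρ i) e) v≈e) φ (p e)

∃̇-intro : (ρ : Vec (V∞ X) n) (i : Fin n) (φ : Formula (suc n)) (v : V∞ X) →
          v ∈ lookup ρ i → v ∷ ρ ⊨ φ → ρ ⊨ ∃̇ i φ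
∃̇-intro ρ i φ v (e , v≈e) p = e , ⊨-resp-≈ v (elem (lookup ρ i) e) ρ v≈e φ p

-- Nonstandard extensions

∋⇒Satisfiable : ExcludedMiddle 0ℓ → (F : βℕ) → ∀ {A} → F ∋ A → Satisfiable A
∋⇒Satisfiable em F F∋A with em
... | yes A≠∅ = A≠∅
... | no  A=∅ = ⊥-elim (βℕ.∌-empty F (βℕ.∋-upward F (λ {n} An → A=∅ (n , An)) F∋A))

=~-refl : (F : βℕ) → F =~ F
=~-refl F = (λ _ F∋A _ → F∋A) , (λ _ F∋A _ → F∋A)

∋-∁-disjoint : (F : βℕ) → ∀ {A} → F ∋ A → ¬ F ∋ ∁ A
∋-∁-disjoint F F∋A F∋∁A =
  βℕ.∌-empty F (βℕ.∋-upward F (λ (An , ¬An) → ¬An An) (βℕ.∋-∩ F F∋A F∋∁A))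

∋-stable : ExcludedMiddle 0ℓ → (F : βℕ) → ∀ {A} → ¬ F ∋ ∁ A → F ∋ A
∋-stable em F F∌∁A = decidable-stable em (F∌∁A ∘ βℕ.∋-ultra F _)

Infinite⇒∃∉ : ExcludedMiddle 0ℓ → {P : Pred X 0ℓ} → Infinite P →
              ∀ ys → ∃ λ z → P z × ¬ (z List.∈ ys)
Infinite⇒∃∉ em infinite ys = decidable-stable em λ ∄ →
  infinite (ys , λ z Pz → decidable-stable em λ z∉ys → ∄ (z , Pz , z∉ys))

-- Indexing by Boolean characteristic functions keeps the power set small;
-- by excluded middle no subset is lost.
powerset : (X : Set) → V∞ X
powerset X = 2 , set (X → Bool) λ χ → proj₂ ⌜ (λ x → χ x ≡ true) ⌝

does-true⇒ : {P : Set} (P? : Dec P) → does P? ≡ true → P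
does-true⇒ (yes p) _ = p

⇒does-true : {P : Set} (P? : Dec P) → P → does P? ≡ true
⇒does-true (yes _)  _ = refl
⇒does-true (no ¬p) p  = contradiction p ¬p

module _ (em : ExcludedMiddle 0ℓ) {*ℕ : Set} (ext : NonstandardExtension *ℕ) where
  open NonstandardExtension ext

  *-transfer : (φ : Formula n) (ρ : Vec (V∞ ℕ⁺) n) → ρ ⊨ φ → map *_ ρ ⊨ φ
  *-transfer φ ρ = Equivalence.to (transfer φ ρ)

  at∈*base : ∀ x → at x ∈ * base ℕ⁺
  at∈*base x = ∈-resp-≈ʳ (at x) (base *ℕ) (* base ℕ⁺)
    (≈-sym (* base ℕ⁺) (base *ℕ) *-base) (x , refl)

  ∈*base⇒at : (v : V∞ *ℕ) → v ∈ * base ℕ⁺ → ∃ λ x → v ≈ at x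
  ∈*base⇒at v = ∈-resp-≈ʳ v (* base ℕ⁺) (base *ℕ) *-base

  -- `*-total` merely picks some value. That a graph is single-valued is a bounded sentence about
  -- `base ℕ⁺` and `graph f`, so it transfers.
  lift₂-unique : (f : ℕ⁺ → ℕ⁺ → ℕ⁺) {x y z : *ℕ} →
                 ⟨ at x , ⟨ at y , at z ⟩ ⟩ ∈ * graph f → z ≡ lift₂ ext f x y
  lift₂-unique f {x} {y} {z} p =
    ∀̇-elim (at z ∷ at y ∷ at x ∷ ρ*) v3 φ₃ (at w) (at∈*base w)
      (∀̇-elim (at y ∷ at x ∷ ρ*) v2 φ₂ (at z) (at∈*base z)
        (∀̇-elim (at x ∷ ρ*) v1 φ₁ (at y) (at∈*base y)
          (∀̇-elim ρ* v0 φ₀ (at x) (at∈*base x) (*-transfer (∀̇ v0 φ₀) ρ functional))))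
      (Equivalence.from (⊨-hasTriple σ v5 v3 v2 v1) p)
      (Equivalence.from (⊨-hasTriple σ v5 v3 v2 v0) (proj₂ (*-total ext f x y)))
    where
    w = lift₂ ext f x y
    ρ = base ℕ⁺ ∷ graph f ∷ []
    ρ* = map *_ ρ
    σ = at w ∷ at z ∷ at y ∷ at x ∷ ρ*
    φ₃ = hasTriple v5 v3 v2 v1 ⇒̇ hasTriple v5 v3 v2 v0 ⇒̇ v1 ≐̇ v0
    φ₂ = ∀̇ v3 φ₃
    φ₁ = ∀̇ v2 φ₂
    φ₀ = ∀̇ v1 φ₁
    functional : ρ ⊨ ∀̇ v0 φ₀
    functional a b c d p q = trans (∈-graph f (Equivalence.to (⊨-hasTriple τ v5 v3 v2 v1) p))
      (sym (∈-graph f (Equivalence.to (⊨-hasTriple τ v5 v3 v2 v0) q)))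
      where τ = at d ∷ at c ∷ at b ∷ at a ∷ ρ

  Star-lift₂ : (f : ℕ⁺ → ℕ⁺ → ℕ⁺) {A C : Subset} → (∀ {a} b → A a → C (f a b)) →
               ∀ {x} y → Star ext A x → Star ext C (lift₂ ext f x y)
  Star-lift₂ f {A} {C} closed {x} y x∈A =
    ∀̇-elim (at y ∷ at x ∷ ρ*) v3 φ₂ (at z) (at∈*base z)
      (∀̇-elim (at x ∷ ρ*) v2 φ₁ (at y) (at∈*base y)
        (∀̇-elim ρ* v0 φ₀ (at x) x∈A (*-transfer (∀̇ v0 φ₀) ρ standard)))
      (Equivalence.from (⊨-hasTriple (at z ∷ at y ∷ at x ∷ ρ*) v5 v2 v1 v0)
        (proj₂ (*-total ext f x y)))
    where
    z = lift₂ ext f x y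
    ρ = ⌜ A ⌝ ∷ base ℕ⁺ ∷ graph f ∷ ⌜ C ⌝ ∷ []
    ρ* = map *_ ρ
    φ₂ = hasTriple v5 v2 v1 v0 ⇒̇ v0 ∈̇ v6
    φ₁ = ∀̇ v3 φ₂
    φ₀ = ∀̇ v2 φ₁
    standard : ρ ⊨ ∀̇ v0 φ₀
    standard (a , Aa) b c p = ⌜⌝-∈ (subst C (sym c≡) (closed b Aa))
      where
      c≡ : c ≡ f a b
      c≡ = ∈-graph f (Equivalence.to (⊨-hasTriple (at c ∷ at b ∷ at a ∷ ρ) v5 v2 v1 v0) p)

  -- Internal sets of hypernaturals

  InternalSet : Pred *ℕ 0ℓ → Set
  InternalSet D = ⌜ D ⌝ ∈ * powerset ℕ⁺

  InternalSet-resp-≐ : ∀ {D E} → D ≐ E → InternalSet D → InternalSet E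
  InternalSet-resp-≐ {D} {E} D≐E = ∈-resp-≈ˡ ⌜ D ⌝ ⌜ E ⌝ (* powerset ℕ⁺) (⌜⌝-cong D≐E)

  InternalSet-U : InternalSet U
  InternalSet-U = ∈-resp-≈ˡ (* base ℕ⁺) ⌜ U ⌝ (* powerset ℕ⁺)
    (≈-trans (* base ℕ⁺) (base *ℕ) ⌜ U ⌝ *-base ((λ x → (x , _) , refl) , (λ (x , _) → x , refl)))
    (*-transfer (v0 ∈̇ v1) (base ℕ⁺ ∷ powerset ℕ⁺ ∷ [])
      ((λ _ → true) , (λ n → (n , refl) , refl) , (λ (n , _) → n , refl)))

  -- Extensionality fails for atoms, which have no elements but differ from the empty set; hence T
  -- must be known not to be an atom. Since its elements are atoms, `D` determines all of them.
  set-of-atoms : (T : V∞ *ℕ) {D : Pred *ℕ 0ℓ} → ¬ (T ∈ * base ℕ⁺) →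
                 (∀ e → elem T e ∈ * base ℕ⁺) → (∀ z → at z ∈ T ⇔ D z) → T ≈ ⌜ D ⌝
  set-of-atoms (n , atom x) T∉base _ _ =
    ⊥-elim (T∉base (∈-resp-≈ˡ (at x) (n , atom x) (* base ℕ⁺) refl (at∈*base x)))
  set-of-atoms T@(suc n , set I f) {D} _ T⊆base ext-D =
    (λ e → let z , e≈z = ∈*base⇒at (elem T e) (T⊆base e)
           in (z , Equivalence.to (ext-D z) (e , ≈-sym (elem T e) (at z) e≈z)) , e≈z) ,
    (λ (z , Dz) → let e , z≈e = Equivalence.from (ext-D z) Dz
                  in e , ≈-sym (at z) (elem T e) z≈e)

  -- The internal definition principle. Bounding the sets by `powerset ℕ⁺` makes comprehension a
  -- bounded sentence. It quantifies over the parameter too, so after transfer a nonstandard x may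
  -- be inserted.
  InternalSet-slice : (φ : Formula (2 ℕ.+ n)) (ρ : Vec (V∞ ℕ⁺) n) (x : *ℕ) {D : Pred *ℕ 0ℓ} →
                      InternalSet D →
                      InternalSet (D ∩ λ z → at z ∷ at x ∷ map *_ ρ ⊨ φ)
  InternalSet-slice {n} φ ρ x {D} D∈ = e , ≈-sym T ⌜ D ∩ P ⌝ (set-of-atoms T T∉base T⊆base T≐D∩P)
    where
    P : Pred *ℕ 0ℓ
    P z = at z ∷ at x ∷ map *_ ρ ⊨ φ
    -- `φ` speaks of z, x and `ρ`; inside the comprehension sentence these stand in the context z,
    -- T, x, S, base, power set, `ρ`.
    shift : Fin (2 ℕ.+ n) → Fin (6 ℕ.+ n)
    shift zero          = v0
    shift (suc zero)    = v2
    shift (suc (suc i)) = suc (suc (suc (suc (suc (suc i)))))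
    ρ₀ : Vec (V∞ ℕ⁺) (2 ℕ.+ n)
    ρ₀ = base ℕ⁺ ∷ powerset ℕ⁺ ∷ ρ
    ρ* = map *_ ρ₀
    φ′ = rename shift φ
    φ₃ = (v0 ∈̇ v1 ⇒̇ v0 ∈̇ v3 ∧̇ φ′) ∧̇ (v0 ∈̇ v3 ∧̇ φ′ ⇒̇ v0 ∈̇ v1)
    -- The first two conjuncts say that T is not an atom and has only atoms as elements, as
    -- `set-of-atoms` requires.
    φ₂ = (v0 ∈̇ v3 ⇒̇ ⊥̇) ∧̇ ∀̇ v0 (v0 ∈̇ v4) ∧̇ ∀̇ v3 φ₃
    φ₁ = ∃̇ v3 φ₂
    φ₀ = ∀̇ v1 φ₁
    shift-Matches : {Y : Set} {y z b p S T : V∞ Y} (τ : Vec (V∞ Y) n) →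
                    Matches (z ∷ y ∷ τ) (z ∷ T ∷ y ∷ S ∷ b ∷ p ∷ τ) shift
    shift-Matches {z = z} τ zero          = ≈-refl z
    shift-Matches {y = y} τ (suc zero)    = ≈-refl y
    shift-Matches         τ (suc (suc i)) = ≈-refl (lookup τ i)
    comprehension : ρ₀ ⊨ ∀̇ v1 φ₀
    -- The witness is the characteristic function obtained by deciding the defining condition with
    -- excluded middle.
    comprehension χ a = (λ c → does (Q? c)) ,
      (λ ()) , (λ (c , _) → c , refl) , λ c →
        (λ p → let c∈χ , q = does-true⇒ (Q? c) (∈-⌜⌝ {A = λ c → does (Q? c) ≡ true} p)
               in c∈χ , Equivalence.to (renamed c) q) ,
        (λ (c∈χ , q) → ⌜⌝-∈ {A = λ c → does (Q? c) ≡ true}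
          (⇒does-true (Q? c) (c∈χ , Equivalence.from (renamed c) q)))
      where
      R : V∞ ℕ⁺
      R = elem (powerset ℕ⁺) χ
      Q? : ∀ c → Dec (at c ∈ R × at c ∷ at a ∷ ρ ⊨ φ)
      Q? c = em
      renamed : ∀ c → at c ∷ at a ∷ ρ ⊨ φ ⇔
        at c ∷ ⌜ (λ c → does (Q? c) ≡ true) ⌝ ∷ at a ∷ R ∷ ρ₀ ⊨ φ′
      renamed c = ⊨-rename _ _ shift (shift-Matches ρ) φ
    S = ⌜ D ⌝
    T-exists = ∀̇-elim (S ∷ ρ*) v1 φ₁ (at x) (at∈*base x)
      (∀̇-elim ρ* v1 φ₀ S D∈ (*-transfer (∀̇ v1 φ₀) ρ₀ comprehension))
    e = proj₁ T-exists
    T = elem (* powerset ℕ⁺) e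
    T∉base = proj₁ (proj₂ T-exists)
    T⊆base = proj₁ (proj₂ (proj₂ T-exists))
    T≐D∩P : ∀ z → at z ∈ T ⇔ (D ∩ P) z
    T≐D∩P z = let to , from = ∀̇-elim (T ∷ at x ∷ S ∷ ρ*) v3 φ₃ (at z) (at∈*base z)
                                (proj₂ (proj₂ (proj₂ T-exists)))
                  open Equivalence (⊨-rename (at z ∷ at x ∷ map *_ ρ) (at z ∷ T ∷ at x ∷ S ∷ ρ*)
                                     shift (shift-Matches (map *_ ρ)) φ) renaming (to to ↑; from to ↓)
              in mk⇔ (λ z∈T → let z∈S , q = to z∈T in ∈-⌜⌝ z∈S , ↓ q)
                     (λ (Dz , p) → from (⌜⌝-∈ Dz , ↑ p))

  InternalSet-Star : *ℕ → ∀ A {D} → InternalSet D → InternalSet (D ∩ Star ext A)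
  InternalSet-Star x A = InternalSet-slice (v0 ∈̇ v2) (⌜ A ⌝ ∷ []) x

  -- The members of `ys` may be nonstandard and a slice takes one such parameter, so they are
  -- removed one at a time.
  InternalSet-∉ : ∀ ys {D} → InternalSet D → InternalSet (D ∩ λ z → ¬ (z List.∈ ys))
  InternalSet-∉ []       D∈ = InternalSet-resp-≐ ((λ Dz → Dz , λ ()) , proj₁) D∈
  InternalSet-∉ (y ∷ ys) D∈ = InternalSet-resp-≐
    ( (λ ((Dz , z∉ys) , z≢y) → Dz , λ { (here z≡y) → z≢y z≡y ; (there z∈ys) → z∉ys z∈ys })
    , (λ (Dz , z∉) → (Dz , z∉ ∘ there) , z∉ ∘ here) )
    (InternalSet-slice (v0 ≐̇ v1 ⇒̇ ⊥̇) [] y (InternalSet-∉ ys D∈))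

  ⊨-∃̇-*base : (ρ : Vec (V∞ *ℕ) n) (i : Fin n) → lookup ρ i ≡ * base ℕ⁺ → ∀ φ →
              ρ ⊨ ∃̇ i φ ⇔ ∃ λ x → at x ∷ ρ ⊨ φ
  ⊨-∃̇-*base ρ i ρi≡ φ = mk⇔ to from
    where
    to : ρ ⊨ ∃̇ i φ → ∃ λ x → at x ∷ ρ ⊨ φ
    to (e , p) =
      let v = elem (lookup ρ i) e
          x , v≈x = ∈*base⇒at v (subst (v ∈_) ρi≡ (elem-∈ (lookup ρ i) e))
      in x , ⊨-resp-≈ v (at x) ρ v≈x φ p
    from : (∃ λ x → at x ∷ ρ ⊨ φ) → ρ ⊨ ∃̇ i φ
    from (x , p) = ∃̇-intro ρ i φ (at x) (subst (at x ∈_) (sym ρi≡) (at∈*base x)) p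

  -- Uniqueness of the value gives one direction, its existence the other.
  ⊨-hasTriple-lift₂ : (f : ℕ⁺ → ℕ⁺ → ℕ⁺) (ρ : Vec (V∞ *ℕ) n) (r i j k : Fin n) (x y z : *ℕ) →
    lookup ρ r ≡ * graph f → lookup ρ i ≡ at x → lookup ρ j ≡ at y → lookup ρ k ≡ at z →
    ρ ⊨ hasTriple r i j k ⇔ z ≡ lift₂ ext f x y
  ⊨-hasTriple-lift₂ f ρ r i j k x y z r≡ i≡ j≡ k≡ = mk⇔
    (λ p → lift₂-unique f {x} {y} {z} (triple-subst r≡ i≡ j≡ k≡ (to p)))
    (λ z≡ → from (triple-subst (sym r≡) (sym i≡) (sym j≡) (trans (cong at (sym z≡)) (sym k≡))
      (proj₂ (*-total ext f x y))))
    where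
    open Equivalence (⊨-hasTriple ρ r i j k)
    triple-subst : ∀ {R R′ u u′ v v′ w w′ : V∞ *ℕ} → R ≡ R′ → u ≡ u′ → v ≡ v′ → w ≡ w′ →
                   ⟨ u , ⟨ v , w ⟩ ⟩ ∈ R → ⟨ u′ , ⟨ v′ , w′ ⟩ ⟩ ∈ R′
    triple-subst refl refl refl refl p = p

  InternalSet-ExactFactor : ∀ x {D} → InternalSet D → InternalSet (D ∩ ExactFactor ext x)
  InternalSet-ExactFactor x D∈ = InternalSet-resp-≐
    ((λ {z} (Dz , p) → Dz , to z p) , (λ {z} (Dz , p) → Dz , from z p))
    (InternalSet-slice φ₀ ρ x D∈)
    where
    ρ = base ℕ⁺ ∷ ⌜ ℙ ⌝ ∷ graph _^_ ∷ graph _·_ ∷ ⌜ _∣_ ⌝₂ ∷ []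
    ρ* = map *_ ρ
    -- Innermost first, the context is x′, a, p, z, x, followed by `ρ`.
    φ₃ = hasTriple v8 v3 v0 v4 ∧̇ (hasPair v9 v2 v0 ⇒̇ ⊥̇)
    φ₂ = v1 ∈̇ v5 ∧̇ hasTriple v6 v1 v0 v2 ∧̇ ∃̇ v4 φ₃
    φ₁ = ∃̇ v3 φ₂
    φ₀ = ∃̇ v2 φ₁
    module _ (z : *ℕ) where
      σ₀ = at z ∷ at x ∷ ρ*
      to : σ₀ ⊨ φ₀ → ExactFactor ext x z
      to s =
        let p , s₁ = Equivalence.to (⊨-∃̇-*base σ₀ v2 refl φ₁) s
            a , p∈ℙ , z≡ , s₂ = Equivalence.to (⊨-∃̇-*base (at p ∷ σ₀) v3 refl φ₂) s₁
            σ₂ = at a ∷ at p ∷ σ₀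
            x′ , x≡ , p∤x′ = Equivalence.to (⊨-∃̇-*base σ₂ v4 refl φ₃) s₂
            σ₃ = at x′ ∷ σ₂
        in p , a , p∈ℙ
         , Equivalence.to (⊨-hasTriple-lift₂ _^_ σ₂ v6 v1 v0 v2 p a z refl refl refl refl) z≡
         , x′
         , Equivalence.to (⊨-hasTriple-lift₂ _·_ σ₃ v8 v3 v0 v4 z x′ x refl refl refl refl) x≡
         , p∤x′ ∘ Equivalence.from (⊨-hasPair σ₃ v9 v2 v0)
      from : ExactFactor ext x z → σ₀ ⊨ φ₀
      from (p , a , p∈ℙ , z≡ , x′ , x≡ , p∤x′) =
        Equivalence.from (⊨-∃̇-*base σ₀ v2 refl φ₁) (p ,
        Equivalence.from (⊨-∃̇-*base (at p ∷ σ₀) v3 refl φ₂) (a , p∈ℙ ,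
        Equivalence.from (⊨-hasTriple-lift₂ _^_ σ₂ v6 v1 v0 v2 p a z refl refl refl refl) z≡ ,
        Equivalence.from (⊨-∃̇-*base σ₂ v4 refl φ₃) (x′ ,
        Equivalence.from (⊨-hasTriple-lift₂ _·_ σ₃ v8 v3 v0 v4 z x′ x refl refl refl refl) x≡ ,
        p∤x′ ∘ Equivalence.to (⊨-hasPair σ₃ v9 v2 v0))))
        where
        σ₂ = at a ∷ at p ∷ σ₀
        σ₃ = at x′ ∷ σ₂

  Star-PrimePowers : ∀ {B} p → tp ext p ∋ ℙ → tp ext p ∋ B → ∀ a →
                     Star ext (PrimePowers B) (_*^_ ext p a)
  Star-PrimePowers p p∈ℙ p∈B a = Star-lift₂ _^_
    (λ b Bq → _ , b , Bq , refl) {p} a (βℕ.∋-∩ (tp ext p) p∈ℙ p∈B)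

  Star-resp-⊆ : ∀ {A B} → A ⊆ B → Star ext A ⊆ Star ext B
  Star-resp-⊆ A⊆B {z} = βℕ.∋-upward (tp ext z) A⊆B

  generates-tp : ∀ x → _generates_ ext x (tp ext x)
  generates-tp x _ = mk⇔ id id

  -- Convex sets belonging to a basic class

  module _ (𝒫 : βℕ) (𝒫∋ℙ : 𝒫 ∋ ℙ) where
    open BasicClass ext 𝒫

    base-prime : (s : Pairs) → tp ext (proj₁ (proj₁ s)) ∋ ℙ
    base-prime ((_ , gen) , _) = Equivalence.from (gen ℙ) 𝒫∋ℙ

    ≈𝒫-refl : ∀ s → s ≈𝒫 s
    ≈𝒫-refl s = =~-refl (tp ext (power s))

    module _ (u : Pred Pairs (lsuc 0ℓ)) (s₀ : Pairs) (u⇔ : ∀ t → u t ⇔ t ≈𝒫 s₀) where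

      𝒦 : Pred βℕ (lsuc 0ℓ)
      𝒦 = basicClass u

      u-s₀ : u s₀
      u-s₀ = Equivalence.from (u⇔ s₀) (≈𝒫-refl s₀)

      𝒦-tp : ∀ {s} → u s → 𝒦 (tp ext (power s))
      𝒦-tp {s} us = s , us , generates-tp (power s)

      ∈ᵇ-intro : ∀ {A} → (∀ s → u s → tp ext (power s) ∋ A) → A ∈ᵇ 𝒦
      ∈ᵇ-intro {A} h F (s , us , gen) = Equivalence.to (gen A) (h s us)

      ∈ᵇ-∩ : ∀ {A B} → A ∈ᵇ 𝒦 → B ∈ᵇ 𝒦 → (A ∩ B) ∈ᵇ 𝒦
      ∈ᵇ-∩ A∈ B∈ F F∈ = βℕ.∋-∩ F (A∈ F F∈) (B∈ F F∈)

      ∈ᵇ⇒Satisfiable : ∀ {A} → A ∈ᵇ 𝒦 → Satisfiable A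
      ∈ᵇ⇒Satisfiable A∈ = ∋⇒Satisfiable em F (A∈ F (𝒦-tp u-s₀))
        where F = tp ext (power s₀)

      PrimePowers-∈ᵇ : ∀ {B} → 𝒫 ∋ B → PrimePowers B ∈ᵇ 𝒦
      PrimePowers-∈ᵇ {B} 𝒫∋B = ∈ᵇ-intro λ s@((p , gen) , a) _ →
        Star-PrimePowers p (base-prime s) (Equivalence.from (gen B) 𝒫∋B) a

      ℙexp-∈ᵇ : ℙexp ∈ᵇ 𝒦
      ℙexp-∈ᵇ F F∈ = βℕ.∋-upward F PrimePowers⊆ℙexp (PrimePowers-∈ᵇ (βℕ.∋-whole 𝒫) F F∈)

      -- The types of all powers in the class are `=~`, so they agree on sets in `𝒰`, and `power s₀`
      -- decides for the whole class whether `A` or, as in the next lemma, `∁ A` belongs to it.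
      𝒰-∈ᵇ : ∀ {A} → 𝒰 A → tp ext (power s₀) ∋ A → A ∈ᵇ 𝒦
      𝒰-∈ᵇ {A} A∈𝒰 p = ∈ᵇ-intro λ s us →
        proj₂ (Equivalence.to (u⇔ s) us) A p A∈𝒰

      𝒰-∁-∈ᵇ : ∀ {A} → 𝒰 A → ¬ tp ext (power s₀) ∋ A → ∁ A ∈ᵇ 𝒦
      𝒰-∁-∈ᵇ {A} A∈𝒰 ¬p = ∈ᵇ-intro λ s us → βℕ.∋-ultra (tp ext (power s)) A λ q →
        ¬p (proj₁ (Equivalence.to (u⇔ s) us) A q A∈𝒰)

      -- These are the sets in 𝒫ᵘ ∩ 𝒞. Nonemptiness is not recorded, since it follows from
      -- membership in the ultrafilters of the class; this makes closure under intersection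
      -- immediate.
      Index : Set₁
      Index = ∃ λ A → A ∈ᵇ 𝒦 × A ⊆ ℙexp × Convex A

      Index⇒𝒞 : (i : Index) → 𝒞 (proj₁ i)
      Index⇒𝒞 (A , A∈ , A⊆ , cA) = ∈ᵇ⇒Satisfiable A∈ , A⊆ , cA

      ℙexp-Index : Index
      ℙexp-Index = ℙexp , ℙexp-∈ᵇ , id , ℙexp-convex

      ℙexp-∩-Index : ∀ {A} → A ∈ᵇ 𝒦 → Convex A → Index
      ℙexp-∩-Index {A} A∈ cA =
        ℙexp ∩ A , ∈ᵇ-∩ ℙexp-∈ᵇ A∈ , proj₁ , ∩-convex {ℙexp} {A} ℙexp-convex cA

      PrimePowers-Index : ∀ {B} → 𝒫 ∋ B → Index
      PrimePowers-Index {B} 𝒫∋B =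
        PrimePowers B , PrimePowers-∈ᵇ 𝒫∋B , PrimePowers⊆ℙexp , PrimePowers-convex

      ⋂ : List Index → Index
      -- Starting from `ℙexp` rather than `U` keeps every intersection inside `ℙexp`.
      ⋂ []                        = ℙexp-Index
      ⋂ ((A , A∈ , _ , cA) ∷ is) =
        let B , B∈ , B⊆ , cB = ⋂ is
        in A ∩ B , ∈ᵇ-∩ A∈ B∈ , B⊆ ∘ proj₂ , ∩-convex {A} {B} cA cB

      ⋂-lower : ∀ is {z} → Star ext (proj₁ (⋂ is)) z → All (λ i → Star ext (proj₁ i) z) is
      ⋂-lower []       _ = []
      ⋂-lower (i ∷ is) {z} p =
        Star-resp-⊆ proj₁ {z} p ∷ ⋂-lower is {z} (Star-resp-⊆ proj₂ {z} p)

      -- Common elements of the extended convex sets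

      module _ (z : *ℕ) (z∈ : (i : Index) → Star ext (proj₁ i) z) where

        -- If `𝒫 ∋ B` but the type of p contained `∁ B`, then z = p^a would lie in the extensions of
        -- two disjoint sets of prime powers. The converse follows by applying this to `∁ B`.
        generates-𝒫 : ∀ p a → tp ext p ∋ ℙ → z ≡ _*^_ ext p a → _generates_ ext p 𝒫
        generates-𝒫 p a p∈ℙ z≡ B = mk⇔
          (λ p∈B → ∋-stable em 𝒫 λ 𝒫∋∁B → ∋-∁-disjoint (tp ext p) {B} p∈B (from (∁ B) 𝒫∋∁B))
          (from B)
          where
          from : ∀ B → 𝒫 ∋ B → tp ext p ∋ B
          from B 𝒫∋B = ∋-stable em (tp ext p) {B} λ p∈∁B → βℕ.∌-empty (tp ext z)
            (βℕ.∋-upward (tp ext z) {PrimePowers B ∩ PrimePowers (∁ B)}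
              (λ (q , q′) → PrimePowers-disjoint q q′)
              (βℕ.∋-∩ (tp ext z) {PrimePowers B} {PrimePowers (∁ B)} (z∈ (PrimePowers-Index 𝒫∋B))
                (subst (Star ext (PrimePowers (∁ B))) (sym z≡) (Star-PrimePowers p p∈ℙ p∈∁B a))))

        z∈-convex : ∀ A → A ∈ᵇ 𝒦 → Convex A → tp ext z ∋ A
        z∈-convex A A∈ cA = Star-resp-⊆ {ℙexp ∩ A} {A} proj₂ {z} (z∈ (ℙexp-∩-Index {A} A∈ cA))

        -- For `A` in `𝒰`, both `A` and `∁ A` are convex and one of them belongs to the class. As z
        -- lies in its extension, z and `power s₀` agree on `A`.
        tp-=~ : tp ext z =~ tp ext (power s₀)
        tp-=~ =
          (λ A z∈A A∈𝒰 → ∋-stable em (tp ext (power s₀)) {A} λ s₀∈∁A → ∋-∁-disjoint (tp ext z) {A} z∈A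
            (z∈-convex (∁ A)
              (𝒰-∁-∈ᵇ A∈𝒰 λ s₀∈A → ∋-∁-disjoint (tp ext (power s₀)) {A} s₀∈A s₀∈∁A)
              (𝒰-∁-convex A∈𝒰))) ,
          (λ A s₀∈A A∈𝒰 → z∈-convex A (𝒰-∈ᵇ A∈𝒰 s₀∈A) (𝒰-convex A∈𝒰))

        generatorOf-power : ∀ s → z ≡ power s → GeneratorOf ext 𝒦 z
        -- The ultrafilter chosen is the type of z itself, which may differ from that of `power s₀`;
        -- being `=~` to the latter places it in the class.
        generatorOf-power s z≡ = tp ext z , (s , u-s , power-generates) , generates-tp z
          where
          s≈s₀ : s ≈𝒫 s₀
          s≈s₀ = subst (λ w → tp ext w =~ tp ext (power s₀)) z≡ tp-=~
          u-s : u s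
          u-s = Equivalence.from (u⇔ s) s≈s₀
          power-generates : _generates_ ext (power s) (tp ext z)
          power-generates = subst (λ w → _generates_ ext w (tp ext z)) z≡ (generates-tp z)

        generatorOf : ∀ p a → tp ext p ∋ ℙ → z ≡ _*^_ ext p a → GeneratorOf ext 𝒦 z
        generatorOf p a p∈ℙ z≡ = generatorOf-power ((p , generates-𝒫 p a p∈ℙ z≡) , a) z≡

      -- Saturation and infinitely many generators

      module _ (saturated : Saturated ext) (x : *ℕ)
               (infinite : ∀ A → A ∈ᵇ 𝒦 → 𝒞 A → Infinite (ExactFactor ext x ∩ Star ext A)) where

        -- The conjuncts are nested in the order in which internality is established, starting from
        -- `U`.
        Candidates : List *ℕ → Index → Pred *ℕ 0ℓ
        Candidates ys (A , _) = ((U ∩ ExactFactor ext x) ∩ λ z → ¬ (z List.∈ ys)) ∩ Star ext A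

        saturate : ∀ ys → ∃ λ z → ∀ i → Candidates ys i z
        saturate ys =
          -- The code of an index is its set `A`, which determines the candidates, so the family has
          -- at most 𝔠 members.
          let v , v∈ = saturated (λ i → ⌜ Candidates ys i ⌝) proj₁ well-defined internal meet
              -- Membership in a single candidate set already makes v an atom.
              z , v≈z , _ = ⌜⌝-elements v (v∈ ℙexp-Index)
          in z , λ i → ∈-⌜⌝ (∈-resp-≈ˡ v (at z) ⌜ Candidates ys i ⌝ v≈z (v∈ i))
          where
          well-defined : ∀ i j → proj₁ i ≐ proj₁ j → ⌜ Candidates ys i ⌝ ≈ ⌜ Candidates ys j ⌝
          well-defined i j (i⊆j , j⊆i) = ⌜⌝-cong
            ( (λ {z} (p , q) → p , Star-resp-⊆ i⊆j {z} q)
            , (λ {z} (p , q) → p , Star-resp-⊆ j⊆i {z} q) )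
          internal : ∀ i → Internal ext ⌜ Candidates ys i ⌝
          internal (A , _) = powerset ℕ⁺ ,
            InternalSet-Star x A (InternalSet-∉ ys (InternalSet-ExactFactor x InternalSet-U))
          meet : ∀ is → ∃ λ v → All (λ i → v ∈ ⌜ Candidates ys i ⌝) is
          meet is =
            -- The finite intersection again lies in 𝒫ᵘ ∩ 𝒞, so its extension contains infinitely
            -- many exact factors, one of them outside `ys`.
            let A , A∈ , _ = ⋂ is
                z , (ef , z∈A) , z∉ys = Infinite⇒∃∉ em (infinite A A∈ (Index⇒𝒞 (⋂ is))) ys
            in at z , All.map (λ {i} z∈i → ⌜⌝-∈ {A = Candidates ys i} (((_ , ef) , z∉ys) , z∈i))
                        (⋂-lower is {z} z∈A)

        ExactFactor⇒GeneratorOf : ∀ z → ExactFactor ext x z →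
                                  ((i : Index) → Star ext (proj₁ i) z) → GeneratorOf ext 𝒦 z
        ExactFactor⇒GeneratorOf z (p , a , p∈ℙ , z≡ , _) z∈ = generatorOf z z∈ p a p∈ℙ z≡

        Candidates⇒GeneratorOf : ∀ ys z → (∀ i → Candidates ys i z) →
          (ExactFactor ext x ∩ GeneratorOf ext 𝒦) z × ¬ (z List.∈ ys)
        Candidates⇒GeneratorOf ys z z∈ =
          (ef , ExactFactor⇒GeneratorOf z ef (λ i → proj₂ (z∈ i))) , proj₂ (proj₁ (z∈ ℙexp-Index))
          where
          ef : ExactFactor ext x z
          ef = proj₂ (proj₁ (proj₁ (z∈ ℙexp-Index)))

        -- One application of saturation yields one generator; excluding an allegedly complete list
        -- `ys` beforehand yields a generator missing from it.
        infinitely-many-generators : Infinite (ExactFactor ext x ∩ GeneratorOf ext 𝒦)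
        infinitely-many-generators (ys , all∈ys) =
          let z , z∈ = saturate ys
              gen , z∉ys = Candidates⇒GeneratorOf ys z z∈
          in z∉ys (all∈ys z gen)

corollary4p9 :
    (∀ {ℓ} → ExcludedMiddle ℓ) →
    {*ℕ : Set} (ext : NonstandardExtension *ℕ) →
    Saturated ext → HensonIP ext →
    (𝒫 : βℕ) → 𝒫 ∋ ℙ →
    let open BasicClass ext 𝒫 in
    (u : Pred Pairs (lsuc 0ℓ)) → IsClass u →
    (x : *ℕ) →
    (∀ A → A ∈ᵇ basicClass u → 𝒞 A →
      Infinite (ExactFactor ext x ∩ Star ext A)) →
    Infinite (ExactFactor ext x ∩ GeneratorOf ext (basicClass u))
corollary4p9 em ext saturated _ 𝒫 𝒫∋ℙ u (s₀ , u⇔) x infinite =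
  infinitely-many-generators em ext 𝒫 𝒫∋ℙ u s₀ u⇔ saturated x infinite
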